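{- Let $A$ be a finite alphabet, $u\in A^*$ and $k\in\{1,\ldots,|u|\}$. The sequence $\left(\binom{u}{x}_q\right)_{x\in A^k}$ uniquely determines the word $u$; that is, if $u'\in A^*$ satisfies $\binom{u'}{x}_q=\binom{u}{x}_q$ for all $x\in A^k$, then $u'=u$.
   Context: $A^*$ is the free monoid of finite words over $A$ (with concatenation and empty word $\varepsilon$), $|w|$ is the length of a word $w$, and $A^k$ is the set of words of length $k$. The $q$-binomial coefficient $\binom{u}{v}_q\in\mathbb{N}[q]$ of two words $u,v\in A^*$ is defined recursively by $\binom{u}{\varepsilon}_q=1$, $\binom{\varepsilon}{v}_q=0$ if $v\neq\varepsilon$, and, for all $u,v\in A^*$ and letters $a,b\in A$, $\binom{ua}{vb}_q=q^{|vb|}\binom{u}{vb}_q+\delta_{a,b}\binom{u}{v}_q$, where $\delta_{a,b}$ is the Kronecker delta. -}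

module Defs where

open import Data.Bool using (if_then_else_)
open import Data.Fin using (Fin)
import Data.Fin.Properties as Fin
open import Data.List using (List; []; _∷_; [_]; _++_; _∷ʳ_; map; replicate; reverse; length)
open import Data.List.Properties using (reverse-++; length-reverse; length-++)
open import Data.Nat using (ℕ; zero; suc; _+_; _*_)
open import Data.Nat.Properties using (+-comm)
open import Function.Bundles using (_↔_)
open import Function.Properties.Inverse using (↔⇒↣)
open import Relation.Binary.Definitions using (DecidableEquality)
open import Relation.Binary.PropositionalEquality using (_≡_; refl)
open import Relation.Nullary.Decidable using (⌊_⌋; via-injection)

infix  4 _≈ₚ_
infixl 6 _+ₚ_
infixl 7 _*ₚ_

-- ℕ[q]: coefficient lists, constant term first.  Trailing zeros are allowed,
-- so equality of polynomials is _≈ₚ_ rather than _≡_.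
Poly : Set
Poly = List ℕ

coeff : Poly → ℕ → ℕ
coeff []      _       = 0
coeff (c ∷ p) zero    = c
coeff (c ∷ p) (suc i) = coeff p i

_≈ₚ_ : Poly → Poly → Set
p ≈ₚ r = ∀ i → coeff p i ≡ coeff r i

0ₚ 1ₚ : Poly
0ₚ = []
1ₚ = [ 1 ]

_+ₚ_ : Poly → Poly → Poly
[]      +ₚ r       = r
(c ∷ p) +ₚ []      = c ∷ p
(c ∷ p) +ₚ (d ∷ r) = (c + d) ∷ (p +ₚ r)

_*ₚ_ : Poly → Poly → Poly
[]      *ₚ r = []
(c ∷ p) *ₚ r = map (c *_) r +ₚ (0 ∷ (p *ₚ r))

q^_ : ℕ → Poly
q^ m = replicate m 0 ++ [ 1 ]

↔Fin⇒≟ : ∀ {a} {A : Set a} {n} → A ↔ Fin n → DecidableEquality A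
↔Fin⇒≟ A↔Fin = via-injection (↔⇒↣ A↔Fin) Fin._≟_

module QBinomial {a} {A : Set a} (_≟_ : DecidableEquality A) where

  δ : A → A → Poly
  δ x y = if ⌊ x ≟ y ⌋ then 1ₚ else 0ₚ

  -- The defining recursion removes last letters, whereas lists are consumed
  -- from the front; binomʳ therefore takes both words reversed.
  binomʳ : List A → List A → Poly
  binomʳ u       []      = 1ₚ
  binomʳ []      (b ∷ v) = 0ₚ
  binomʳ (a ∷ u) (b ∷ v) =
    (q^ length (b ∷ v)) *ₚ binomʳ u (b ∷ v) +ₚ δ a b *ₚ binomʳ u v

  binom : List A → List A → Poly
  binom u v = binomʳ (reverse u) (reverse v)

  -- binom satisfies the defining recursion of the q-binomial coefficients;
  -- every nonempty word has the form v ∷ʳ b.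
  binom-ε : ∀ u → binom u [] ≡ 1ₚ
  binom-ε u = refl

  binom-ε-∷ʳ : ∀ v b → binom [] (v ∷ʳ b) ≡ 0ₚ
  binom-ε-∷ʳ v b rewrite reverse-++ v [ b ] = refl

  binom-∷ʳ-∷ʳ : ∀ u v a b → binom (u ∷ʳ a) (v ∷ʳ b) ≡
    (q^ length (v ∷ʳ b)) *ₚ binom u (v ∷ʳ b) +ₚ δ a b *ₚ binom u v
  binom-∷ʳ-∷ʳ u v a b
    rewrite reverse-++ u [ a ] | reverse-++ v [ b ]
          | length-reverse v | length-++ v {[ b ]} | +-comm (length v) 1 = refl

{-# OPTIONS --safe #-}
module Submission where

open import Data.Fin using (Fin)
open import Data.List using (List; length)
open import Data.Nat using (ℕ; _≤_)
open import Function.Bundles using (_↔_)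
open import Relation.Binary.PropositionalEquality using (_≡_)
open import Defs

open import Data.Bool using (true; false)
open import Data.List using ([]; _∷_; [_]; _++_; _∷ʳ_; map; reverse)
open import Data.List.Properties
  using (++-assoc; length-++; length-reverse; reverse-involutive; reverse-injective)
open import Data.Nat using (zero; suc; _+_; _*_; s≤s)
open import Data.Nat.Properties
  using (+-identityʳ; +-assoc; +-comm; +-suc; +-cancelˡ-≡; ≤-reflexive; ≤-trans; m≤m+n; m≤n+m)
open import Data.Product using (∃; ∃₂; _×_; _,_)
open import Relation.Binary.Definitions using (DecidableEquality)
open import Relation.Binary.PropositionalEquality
  using (refl; sym; trans; cong; cong₂; subst₂; module ≡-Reasoning)
open import Relation.Nullary using (yes; no; contradiction)
open import Relation.Nullary.Decidable using (⌊_⌋)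

-- An occurrence of x as a subword of u, with the i-th letter of x from the
-- right at position pᵢ of u from the right, contributes q^Σ(pᵢ − i) to the
-- coefficient.  So the constant term tests whether x is a suffix of u.  If
-- x = by has length k, an occurrence of degree d has b at position at most
-- d + k, with equality only if y is matched as a suffix.  For u = sty the
-- coefficient of degree |t| is therefore the one for ty, plus one exactly when
-- s ends with b, and u is recovered letter by letter from the right.  All words
-- are reversed below, as in binomʳ, so suffixes become prefixes.

coeff-+ₚ : ∀ p r i → coeff (p +ₚ r) i ≡ coeff p i + coeff r i
coeff-+ₚ []      r       i       = refl
coeff-+ₚ (c ∷ p) []      i       = sym (+-identityʳ _)
coeff-+ₚ (c ∷ p) (d ∷ r) zero    = refl
coeff-+ₚ (c ∷ p) (d ∷ r) (suc i) = coeff-+ₚ p r i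

coeff-0*ₚ : ∀ p i → coeff (map (0 *_) p) i ≡ 0
coeff-0*ₚ []      i       = refl
coeff-0*ₚ (c ∷ p) zero    = refl
coeff-0*ₚ (c ∷ p) (suc i) = coeff-0*ₚ p i

coeff-1*ₚ : ∀ p → 1ₚ *ₚ p ≈ₚ p
coeff-1*ₚ p i = trans (coeff-+ₚ (map (1 *_) p) [ 0 ] i)
  (trans (cong₂ _+_ (map-1* p i) (coeff-[0] i)) (+-identityʳ _))
  where
  map-1* : ∀ p → map (1 *_) p ≈ₚ p
  map-1* []      i       = refl
  map-1* (c ∷ p) zero    = +-identityʳ c
  map-1* (c ∷ p) (suc i) = map-1* p i

  coeff-[0] : ∀ i → coeff [ 0 ] i ≡ 0
  coeff-[0] zero    = refl
  coeff-[0] (suc i) = refl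

coeff-q^*ₚ-zero : ∀ m p → coeff ((q^ suc m) *ₚ p) 0 ≡ 0
coeff-q^*ₚ-zero m p = trans (coeff-+ₚ (map (0 *_) p) _ 0)
  (cong (_+ 0) (coeff-0*ₚ p 0))

coeff-q^*ₚ-suc : ∀ m p i → coeff ((q^ suc m) *ₚ p) (suc i) ≡ coeff ((q^ m) *ₚ p) i
coeff-q^*ₚ-suc m p i = trans (coeff-+ₚ (map (0 *_) p) _ (suc i))
  (cong (_+ coeff ((q^ m) *ₚ p) i) (coeff-0*ₚ p (suc i)))

-- Multiplication by `q^ m` shifts degrees up by `m`. Writing the source degree as an `i` with
-- `m + i ≡ d` avoids truncated subtraction: for `d` below `m` there is no such `i`.
coeff-q^*ₚ-cong : ∀ m p r d → (∀ i → m + i ≡ d → coeff p i ≡ coeff r i) →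
  coeff ((q^ m) *ₚ p) d ≡ coeff ((q^ m) *ₚ r) d
coeff-q^*ₚ-cong zero p r d p≈r =
  trans (coeff-1*ₚ p d) (trans (p≈r d refl) (sym (coeff-1*ₚ r d)))
coeff-q^*ₚ-cong (suc m) p r zero p≈r =
  trans (coeff-q^*ₚ-zero m p) (sym (coeff-q^*ₚ-zero m r))
coeff-q^*ₚ-cong (suc m) p r (suc d) p≈r =
  trans (coeff-q^*ₚ-suc m p d)
    (trans (coeff-q^*ₚ-cong m p r d λ i eq → p≈r i (cong suc eq)) (sym (coeff-q^*ₚ-suc m r d)))

length-∷ʳ : ∀ {a} {A : Set a} (y : List A) b → length (y ∷ʳ b) ≡ suc (length y)
length-∷ʳ y b = trans (length-++ y) (+-comm (length y) 1)

-- The last letter `e` is kept apart from `y` because the words used as tests share `y` and vary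
-- only in the letter after it.
split-at : ∀ {a} {A : Set a} j (u : List A) → suc j ≤ length u →
  ∃₂ λ y e → length y ≡ j × ∃ λ s → u ≡ (y ∷ʳ e) ++ s
split-at zero    (c ∷ u) _       = [] , c , refl , u , refl
split-at (suc j) (c ∷ u) (s≤s l) with split-at j u l
... | y , e , refl , s , refl = c ∷ y , e , refl , s , refl

module Reconstruction {a} {A : Set a} (_≟_ : DecidableEquality A) where
  open QBinomial _≟_

  coeff-δ*ₚ-cong : ∀ x y p r i → coeff p i ≡ coeff r i →
    coeff (δ x y *ₚ p) i ≡ coeff (δ x y *ₚ r) i
  coeff-δ*ₚ-cong x y p r i eq with ⌊ x ≟ y ⌋
  ... | true  = trans (coeff-1*ₚ p i) (trans eq (sym (coeff-1*ₚ r i)))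
  ... | false = refl

  coeff-δ-refl*ₚ : ∀ x p → δ x x *ₚ p ≈ₚ p
  coeff-δ-refl*ₚ x p i with x ≟ x
  ... | yes _  = coeff-1*ₚ p i
  ... | no x≢x = contradiction refl x≢x

  coeff-binomʳ-∷-∷ : ∀ c u b v d → coeff (binomʳ (c ∷ u) (b ∷ v)) d ≡
    coeff ((q^ suc (length v)) *ₚ binomʳ u (b ∷ v)) d + coeff (δ c b *ₚ binomʳ u v) d
  coeff-binomʳ-∷-∷ c u b v =
    coeff-+ₚ ((q^ suc (length v)) *ₚ binomʳ u (b ∷ v)) (δ c b *ₚ binomʳ u v)

  coeff₀-binomʳ-∷-∷ : ∀ c u b v →
    coeff (binomʳ (c ∷ u) (b ∷ v)) 0 ≡ coeff (δ c b *ₚ binomʳ u v) 0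
  coeff₀-binomʳ-∷-∷ c u b v = trans (coeff-binomʳ-∷-∷ c u b v 0)
    (cong (_+ coeff (δ c b *ₚ binomʳ u v) 0)
      (coeff-q^*ₚ-zero (length v) (binomʳ u (b ∷ v))))

  coeff₀-prefix : ∀ x z → coeff (binomʳ (x ++ z) x) 0 ≡ 1
  coeff₀-prefix []      z = refl
  coeff₀-prefix (b ∷ x) z = trans (coeff₀-binomʳ-∷-∷ b (x ++ z) b x)
    (trans (coeff-δ-refl*ₚ b (binomʳ (x ++ z) x) 0) (coeff₀-prefix x z))

  -- Only the `δ` summand reaches degree 0, so a single mismatch makes the constant term 0; the
  -- value 1 forces agreement letter by letter.
  coeff₀≡1⇒prefix : ∀ x u → coeff (binomʳ u x) 0 ≡ 1 → ∃ λ z → u ≡ x ++ z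
  coeff₀≡1⇒prefix []      u       _  = u , refl
  coeff₀≡1⇒prefix (b ∷ x) (c ∷ u) eq
    with c ≟ b | trans (sym (coeff₀-binomʳ-∷-∷ c u b x)) eq
  ... | yes refl | eq′ with coeff₀≡1⇒prefix x u (trans (sym (coeff-1*ₚ (binomʳ u x) 0)) eq′)
  ...   | z , refl = z , refl

  -- An occurrence of `x` that reaches into `z` has its last letter at position at least `length w`,
  -- counted from 0, so its degree is at least `length w + 1 - length x`, which exceeds `d`.
  coeff-binomʳ-++ : ∀ w z x d → d + length x ≤ length w →
    coeff (binomʳ (w ++ z) x) d ≡ coeff (binomʳ w x) d
  coeff-binomʳ-++ []      z []      d l = refl
  coeff-binomʳ-++ (c ∷ w) z []      d l = refl
  coeff-binomʳ-++ []      z (b ∷ v) d l rewrite +-suc d (length v) with () ← l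
  coeff-binomʳ-++ (c ∷ w) z (b ∷ v) d l rewrite +-suc d (length v) with s≤s l′ ← l = begin
    coeff (binomʳ (c ∷ w ++ z) (b ∷ v)) d
      ≡⟨ coeff-binomʳ-∷-∷ c (w ++ z) b v d ⟩
    coeff ((q^ k) *ₚ binomʳ (w ++ z) (b ∷ v)) d + coeff (δ c b *ₚ binomʳ (w ++ z) v) d
      -- In the first summand the degree falls to `i` with `i + k ≡ d`, and
      -- `d ≤ d + length v ≤ length w`, so the bound survives the loss of `c`.
      ≡⟨ cong₂ _+_
           (coeff-q^*ₚ-cong k (binomʳ (w ++ z) (b ∷ v)) (binomʳ w (b ∷ v)) d λ i eq →
             coeff-binomʳ-++ w z (b ∷ v) i
             (≤-trans (≤-reflexive (trans (+-comm i k) eq)) (≤-trans (m≤m+n d _) l′)))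
           (coeff-δ*ₚ-cong c b (binomʳ (w ++ z) v) (binomʳ w v) d (coeff-binomʳ-++ w z v d l′)) ⟩
    coeff ((q^ k) *ₚ binomʳ w (b ∷ v)) d + coeff (δ c b *ₚ binomʳ w v) d
      ≡⟨ coeff-binomʳ-∷-∷ c w b v d ⟨
    coeff (binomʳ (c ∷ w) (b ∷ v)) d ∎
    where
    open ≡-Reasoning
    k = suc (length v)

  -- Here degree plus word length exceeds `length (y ++ t)` by exactly one, the first case beyond
  -- `coeff-binomʳ-++`. The only new occurrence matches `y` as a prefix and `b` with the first
  -- letter of `s`.
  coeff-binomʳ-next : ∀ y t s b → coeff (binomʳ ((y ++ t) ++ s) (y ∷ʳ b)) (length t) ≡
    coeff (binomʳ (y ++ t) (y ∷ʳ b)) (length t) + coeff (binomʳ s [ b ]) 0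
  coeff-binomʳ-next [] [] s b = refl
  -- The summand matching `c` with `b` does not depend on what follows `c`, so the same `e` serves
  -- `t` and `t ++ s`.
  coeff-binomʳ-next [] (c ∷ t) s b = begin
    coeff (binomʳ (c ∷ t ++ s) [ b ]) (suc d)
      ≡⟨ step (t ++ s) ⟩
    coeff (binomʳ (t ++ s) [ b ]) d + e
      ≡⟨ cong (_+ e) (coeff-binomʳ-next [] t s b) ⟩
    (coeff (binomʳ t [ b ]) d + f) + e
      ≡⟨ +-assoc (coeff (binomʳ t [ b ]) d) f e ⟩
    coeff (binomʳ t [ b ]) d + (f + e)
      ≡⟨ cong (coeff (binomʳ t [ b ]) d +_) (+-comm f e) ⟩
    coeff (binomʳ t [ b ]) d + (e + f)
      ≡⟨ +-assoc (coeff (binomʳ t [ b ]) d) e f ⟨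
    (coeff (binomʳ t [ b ]) d + e) + f
      ≡⟨ cong (_+ f) (step t) ⟨
    coeff (binomʳ (c ∷ t) [ b ]) (suc d) + f ∎
    where
    open ≡-Reasoning
    d = length t
    e = coeff (δ c b *ₚ 1ₚ) (suc d)
    f = coeff (binomʳ s [ b ]) 0
    step : ∀ u → coeff (binomʳ (c ∷ u) [ b ]) (suc d) ≡ coeff (binomʳ u [ b ]) d + e
    step u = trans (coeff-binomʳ-∷-∷ c u b [] (suc d))
      (cong (_+ e) (trans (coeff-q^*ₚ-suc 0 (binomʳ u [ b ]) d) (coeff-1*ₚ (binomʳ u [ b ]) d)))
  coeff-binomʳ-next (c ∷ y) t s b = begin
    coeff (binomʳ (c ∷ (y ++ t) ++ s) (c ∷ y ∷ʳ b)) d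
      ≡⟨ step ((y ++ t) ++ s) ⟩
    coeff ((q^ k) *ₚ binomʳ ((y ++ t) ++ s) (c ∷ y ∷ʳ b)) d + coeff (binomʳ ((y ++ t) ++ s) (y ∷ʳ b)) d
      -- Skipping `c` costs degree `k`, which brings the first summand back within the range of
      -- `coeff-binomʳ-++`; only the second summand sees `s`.
      ≡⟨ cong₂ _+_
           (coeff-q^*ₚ-cong k (binomʳ ((y ++ t) ++ s) (c ∷ y ∷ʳ b)) (binomʳ (y ++ t) (c ∷ y ∷ʳ b)) d
             λ i eq → coeff-binomʳ-++ (y ++ t) s (c ∷ y ∷ʳ b) i
             (≤-trans (≤-reflexive (trans (+-comm i k) eq)) d≤∣y++t∣))
           (coeff-binomʳ-next y t s b) ⟩
    e + (coeff (binomʳ (y ++ t) (y ∷ʳ b)) d + f)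
      ≡⟨ +-assoc e _ f ⟨
    (e + coeff (binomʳ (y ++ t) (y ∷ʳ b)) d) + f
      ≡⟨ cong (_+ f) (step (y ++ t)) ⟨
    coeff (binomʳ (c ∷ y ++ t) (c ∷ y ∷ʳ b)) d + f ∎
    where
    open ≡-Reasoning
    d = length t
    k = suc (length (y ∷ʳ b))
    e = coeff ((q^ k) *ₚ binomʳ (y ++ t) (c ∷ y ∷ʳ b)) d
    f = coeff (binomʳ s [ b ]) 0
    d≤∣y++t∣ : d ≤ length (y ++ t)
    d≤∣y++t∣ = ≤-trans (m≤n+m d (length y)) (≤-reflexive (sym (length-++ y)))
    step : ∀ u → coeff (binomʳ (c ∷ u) (c ∷ y ∷ʳ b)) d ≡
      coeff ((q^ k) *ₚ binomʳ u (c ∷ y ∷ʳ b)) d + coeff (binomʳ u (y ∷ʳ b)) d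
    step u = trans (coeff-binomʳ-∷-∷ c u c (y ∷ʳ b) d)
      (cong (coeff ((q^ k) *ₚ binomʳ u (c ∷ y ∷ʳ b)) d +_) (coeff-δ-refl*ₚ c (binomʳ u (y ∷ʳ b)) d))

  -- Induction on `s`, with `t` collecting the letters already recovered. In degree `length t` the
  -- contribution of `y ++ t` cancels, which leaves the test for the next letter.
  tails-unique : ∀ y t s s′ →
    (∀ b → binomʳ ((y ++ t) ++ s) (y ∷ʳ b) ≈ₚ binomʳ ((y ++ t) ++ s′) (y ∷ʳ b)) → s ≡ s′
  tails-unique y t s s′ H = go s s′ H heads
    where
    heads : ∀ b → coeff (binomʳ s [ b ]) 0 ≡ coeff (binomʳ s′ [ b ]) 0
    heads b = +-cancelˡ-≡ (coeff (binomʳ (y ++ t) (y ∷ʳ b)) (length t)) _ _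
      (trans (sym (coeff-binomʳ-next y t s b))
        (trans (H b (length t)) (coeff-binomʳ-next y t s′ b)))

    go : ∀ s s′ →
      (∀ b → binomʳ ((y ++ t) ++ s) (y ∷ʳ b) ≈ₚ binomʳ ((y ++ t) ++ s′) (y ∷ʳ b)) →
      (∀ b → coeff (binomʳ s [ b ]) 0 ≡ coeff (binomʳ s′ [ b ]) 0) → s ≡ s′
    go []      []        _ _ = refl
    -- An ended word answers 0 for every letter, so the end of the word is detected too.
    go []      (c′ ∷ s′) _ h with () ← trans (h c′) (coeff₀-prefix [ c′ ] s′)
    go (c ∷ s) s′        H h
      with coeff₀≡1⇒prefix [ c ] s′ (trans (sym (h c)) (coeff₀-prefix [ c ] s))
    ... | r , refl = cong (c ∷_) (tails-unique y (t ∷ʳ c) s r λ b i →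
      subst₂ (λ u u′ → coeff (binomʳ u (y ∷ʳ b)) i ≡ coeff (binomʳ u′ (y ∷ʳ b)) i)
        (shift s) (shift r) (H b i))
      where
      shift : ∀ z → (y ++ t) ++ c ∷ z ≡ (y ++ (t ∷ʳ c)) ++ z
      shift z = trans (sym (++-assoc (y ++ t) [ c ] z)) (cong (_++ z) (++-assoc y t [ c ]))

  binomʳ-determines : ∀ u k → 1 ≤ k → k ≤ length u → ∀ u′ →
    (∀ x → length x ≡ k → binomʳ u′ x ≈ₚ binomʳ u x) → u′ ≡ u
  binomʳ-determines u (suc j) _ l u′ H with split-at j u l
  ... | y , e , refl , s , refl
    -- The constant term at the prefix of length `k` is 1 for `u`, hence for `u′`; both words begin
    -- with `y ∷ʳ e`, and recovery starts from `t = [ e ]`.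
    with coeff₀≡1⇒prefix (y ∷ʳ e) u′
           (trans (H (y ∷ʳ e) (length-∷ʳ y e) 0) (coeff₀-prefix (y ∷ʳ e) s))
  ...   | r , refl = cong ((y ∷ʳ e) ++_) (tails-unique y [ e ] r s λ b →
    H (y ∷ʳ b) (length-∷ʳ y b))

  -- Reversal permutes the words of length `k`, so the hypothesis carries over to `binomʳ`.
  binom-determines : ∀ u k → 1 ≤ k → k ≤ length u → ∀ u′ →
    (∀ x → length x ≡ k → binom u′ x ≈ₚ binom u x) → u′ ≡ u
  binom-determines u k 1≤k k≤∣u∣ u′ H = reverse-injective
    (binomʳ-determines (reverse u) k 1≤k
      (≤-trans k≤∣u∣ (≤-reflexive (sym (length-reverse u)))) (reverse u′)
      λ x ∣x∣≡k i → subst₂ (λ v w → coeff (binomʳ (reverse u′) v) i ≡ coeff (binomʳ (reverse u) w) i)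
        (reverse-involutive x) (reverse-involutive x)
        (H (reverse x) (trans (length-reverse x) ∣x∣≡k) i))

corollary4p2 : ∀ {a} {A : Set a} {n : ℕ} (A-finite : A ↔ Fin n) →
    let open QBinomial (↔Fin⇒≟ A-finite) in
    (u : List A) (k : ℕ) → 1 ≤ k → k ≤ length u →
    (u′ : List A) →
    (∀ (x : List A) → length x ≡ k → binom u′ x ≈ₚ binom u x) →
    u′ ≡ u
corollary4p2 A-finite = Reconstruction.binom-determines (↔Fin⇒≟ A-finite)
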